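{- Suppose there exist an integer $\mathrm{H}_k(n;k)$, say $A$, and an $n\times n$ shiftable p.f. array $B$ (with entries in $\mathbb{Z}$) such that: (1) each row and each column of $B$ contains $h$ filled cells; (2) $supp(B)=\left[1,\frac{h}{2}(2n+1)\right]\setminus T$, where $T=\left\{(2n+1),2(2n+1),\dots,\frac{h}{2}(2n+1)\right\}$ if $k$ is even, and $T=\left\{(n+1),(n+1)+(2n+1),\dots,(n+1)+\frac{h-2}{2}(2n+1)\right\}$ if $k$ is odd; (3) the elements in every row and every column of $B$ sum to $0$; (4) $skel(A)\cap skel(B)=\emptyset$. Then there exists an integer $\mathrm{H}_{k+h}(n;k+h)$.
   Context: A partially filled (p.f.) $m\times n$ array is an $m\times n$ matrix in which some cells are allowed to be empty. Let $n,k,t$ be positive integers such that $t$ divides $2nk$, let $v=2nk+t$, and let $J$ be the subgroup of $\mathbb{Z}_v$ of order $t$. An $\mathrm{H}_t(n;k)$ (square Heffter array over $\mathbb{Z}_v$ relative to $J$) is an $n\times n$ p.f. array with elements in $\mathbb{Z}_v$ such that: each row and each column contains exactly $k$ filled cells; for every $x\in\mathbb{Z}_v\setminus J$, either $x$ or $-x$ appears in the array; the elements in every row and every column sum to $0$ in $\mathbb{Z}_v$. It is called integer if the elements in every row and every column, viewed as integers in $\pm\{1,\ldots,\lfloor\frac{2nk+t}{2}\rfloor\}$, sum to zero in $\mathbb{Z}$. For integers $a\le b$, $[a,b]=\{a,a+1,\ldots,b\}$. The support $supp(B)$ of a p.f. array $B$ with integer entries is the set of absolute values of its entries. The skeleton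 $skel(A)$ of a p.f. array $A$ is the set of its filled positions. A square p.f. array with entries in $\mathbb{Z}$ is shiftable if every row and every column contains an equal number of positive and negative entries (with every entry nonzero); in particular $h$ above is even. -}

module Defs where

open import Data.Bool.Base using (if_then_else_)
open import Data.Fin.Base using (Fin; toℕ)
open import Data.Fin.Properties using (nonZeroIndex)
import Data.Fin.Subset as Subset
open Subset using (Subset)
open import Data.Integer.Base as ℤ using (ℤ; 0ℤ; ∣_∣; +_)
import Data.Integer.Divisibility as ℤDiv
import Data.Integer.Properties as ℤProp
open import Data.List.Base using (List; length; filter; foldr; map; catMaybes)
open import Data.Maybe using (Maybe; just; Is-just)
open import Data.Maybe.Relation.Binary.Pointwise using (Pointwise)
open import Data.Nat.Base using (ℕ; _+_; _*_; _∸_; _≤_; _<_)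
open import Data.Nat.Divisibility using (_∣_; _∣?_)
open import Data.Nat.DivMod using (_/_; _mod_)
open import Data.Nat.ListAction using (sum)
open import Data.Product.Base using (_×_; ∃-syntax; _,_)
open import Data.Sum.Base using (_⊎_)
open import Data.Vec.Functional using (Vector; toList; transpose)
open import Level using (Level; 0ℓ)
open import Relation.Binary.PropositionalEquality using (_≡_; _≢_)
open import Relation.Nullary.Decidable using (does)
open import Relation.Unary using (Pred)

private
  variable
    a : Level
    X : Set a
    m n v : ℕ

-- ℤ_v has carrier Fin v; an element of it already witnesses v ≢ 0, so the
-- operations need no NonZero argument.

infixl 6 _⊕_

_⊕_ : Fin v → Fin v → Fin v
_⊕_ {v} x y = ((toℕ x + toℕ y) mod v) {{nonZeroIndex x}}

⊖_ : Fin v → Fin v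
⊖_ {v} x = ((v ∸ toℕ x) mod v) {{nonZeroIndex x}}

record IsSubgroup (J : Subset v) : Set where
  field
    contains-0 : ∀ x → toℕ x ≡ 0 → x Subset.∈ J
    closed-⊕   : ∀ x y → x Subset.∈ J → y Subset.∈ J → (x ⊕ y) Subset.∈ J
    closed-⊖   : ∀ x → x Subset.∈ J → (⊖ x) Subset.∈ J

SumsToZeroMod : (v : ℕ) → List (Fin v) → Set
SumsToZeroMod v xs = v ∣ sum (map toℕ xs)

-- z is x viewed as an integer in ±{1, …, ⌊v/2⌋}.

Represents : Fin v → ℤ → Set
Represents {v} x z =
  (+ v) ℤDiv.∣ (z ℤ.- + toℕ x) × 1 ≤ ∣ z ∣ × ∣ z ∣ ≤ v / 2

-- nothing marks an empty cell.

PFArray : ℕ → ℕ → Set a → Set a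
PFArray m n X = Vector (Vector (Maybe X) n) m

entries : Vector (Maybe X) n → List X
entries line = catMaybes (toList line)

EveryLine : (List X → Set) → PFArray m n X → Set
EveryLine P A =
    (∀ i → P (entries (A i)))
  × (∀ j → P (entries (transpose A j)))

_AppearsIn_ : {X : Set a} → X → PFArray m n X → Set a
x AppearsIn A = ∃[ i ] ∃[ j ] A i j ≡ just x

skel : {X : Set a} → PFArray m n X → Pred (Fin m × Fin n) a
skel A (i , j) = Is-just (A i j)

supp : PFArray m n ℤ → Pred ℕ 0ℓ
supp B x = ∃[ z ] z AppearsIn B × ∣ z ∣ ≡ x

SumsToZero : List ℤ → Set
SumsToZero zs = foldr ℤ._+_ 0ℤ zs ≡ 0ℤ

Balanced : List ℤ → Set
Balanced zs = length (filter (0ℤ ℤProp.<?_) zs) ≡ length (filter (ℤProp._<? 0ℤ) zs)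

record IsShiftable (B : PFArray n n ℤ) : Set where
  field
    nonzero  : ∀ z → z AppearsIn B → z ≢ 0ℤ
    balanced : EveryLine Balanced B

modulus : (t n k : ℕ) → ℕ
modulus t n k = 2 * n * k + t

-- J is the subgroup of order t, which is unique because ℤ_v is cyclic.

record IsHeffter (t n k : ℕ) (A : PFArray n n (Fin (modulus t n k))) : Set where
  field
    n-positive : 0 < n
    k-positive : 0 < k
    t-positive : 0 < t
    t-divides  : t ∣ 2 * n * k
    J          : Subset (modulus t n k)
    J-subgroup : IsSubgroup J
    J-order    : Subset.∣ J ∣ ≡ t
    filled     : EveryLine (λ xs → length xs ≡ k) A
    covers     : ∀ x → x Subset.∉ J → (x AppearsIn A) ⊎ ((⊖ x) AppearsIn A)
    sums       : EveryLine (SumsToZeroMod (modulus t n k)) A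

record IsIntegerHeffter (t n k : ℕ) (A : PFArray n n (Fin (modulus t n k))) : Set where
  field
    isHeffter    : IsHeffter t n k A
    asIntegers   : PFArray n n ℤ
    represents   : ∀ i j → Pointwise Represents (A i j) (asIntegers i j)
    integer-sums : EveryLine SumsToZero asIntegers

[_⋯_] : ℕ → ℕ → Pred ℕ 0ℓ
[ a ⋯ b ] x = a ≤ x × x ≤ b

-- For odd k the last index (h - 2)/2 is expressed as j < h / 2.

T : (n k h : ℕ) → Pred ℕ 0ℓ
T n k h = if does (2 ∣? k)
  then (λ x → ∃[ j ] 1 ≤ j × j ≤ h / 2 × x ≡ j * (2 * n + 1))
  else (λ x → ∃[ j ] j < h / 2 × x ≡ (n + 1) + j * (2 * n + 1))

{-# OPTIONS --safe #-}

-- Put N = 2n+1 and v = 2nk+k = kN.  By Lagrange, J consists of multiples of N,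
-- so A covers every non-multiple of N up to ⌊v/2⌋.  Move the entries of B away
-- from 0 by ⌊v/2⌋: balancedness keeps the line sums at 0, and T is chosen so
-- that the missing absolute values again become multiples of N, whatever the
-- parity of k.  The shifted B covers the non-multiples of N in the next hN/2
-- integers, up to ⌊(k+h)N/2⌋, so it can be laid over A.

module Submission where

open import Defs
open import Algebra.Bundles using (AbelianGroup)
import Algebra.Properties.CommutativeMonoid.Sum
import Algebra.Properties.Group as Group
open import Data.Bool.Base using (Bool; true; false; if_then_else_)
open import Data.Fin.Base using (Fin; zero; suc; toℕ; fromℕ<)
open import Data.Fin.Permutation using (Permutation; permutation)
open import Data.Fin.Properties using (toℕ<n; toℕ-fromℕ<; toℕ-injective; nonZeroIndex)
import Data.Fin.Subset as Subset
open Subset using (Subset)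
open import Data.Integer.Base as ℤ using (ℤ; 0ℤ; ∣_∣; +_; -[1+_])
import Data.Integer.DivMod as ℤDivMod
import Data.Integer.Divisibility.Signed as ℤDiv
import Data.Integer.Properties as ℤ
import Data.Integer.Tactic.RingSolver as ℤSolver
open import Data.List.Base using (List; []; _∷_; _++_; length; filter; foldr; map; catMaybes)
open import Data.List.Properties using (length-++; length-map; map-tabulate; map-catMaybes)
open import Data.List.Relation.Binary.Permutation.Propositional as Perm using (_↭_; ↭-sym; ↭⇒↭ₛ)
open import Data.List.Relation.Binary.Permutation.Propositional.Properties
  using (↭-length) renaming (shift to ↭-shift)
import Data.List.Relation.Binary.Permutation.Setoid.Properties as Permₛ
open import Data.List.Relation.Unary.All using (All; []; _∷_)
open import Data.Maybe using (Is-just)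
open import Data.Maybe.Base as Maybe using (Maybe; just; nothing; _<∣>_)
open import Data.Maybe.Relation.Binary.Pointwise using (Pointwise; just; nothing)
open import Data.Maybe.Relation.Unary.Any using (just)
open import Data.Nat.Base using (ℕ; zero; suc; s≤s; _+_; _*_; _∸_; _≤_; _<_; NonZero; >-nonZero)
open import Data.Nat.Divisibility
open import Data.Nat.DivMod
open import Data.Nat.ListAction using (sum)
open import Data.Nat.Properties
open import Data.Nat.Tactic.RingSolver using (solve-∀)
open import Data.Product.Base using (∃-syntax; _×_; _,_; proj₁; proj₂)
open import Data.Sum.Base using (_⊎_; inj₁; inj₂)
open import Data.Unit.Base using (tt)
open import Data.Vec.Base using (lookup; []; _∷_; tabulate)
open import Data.Vec.Functional using (Vector; toList; transpose)
open import Data.Vec.Properties using (lookup∘tabulate; lookup⇒[]=; []=⇒lookup)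
open import Function.Base using (_∘_)
open import Relation.Binary.PropositionalEquality hiding (J)
open import Relation.Nullary.Decidable using (does; yes; no; dec-true; dec-false)
open import Relation.Nullary.Negation using (¬_; contradiction)
open import Relation.Unary using (_≐_; _∖_; _∩_; Empty)

open Algebra.Properties.CommutativeMonoid.Sum +-0-commutativeMonoid
  using (sum-permute; ∑-distrib-+; sum-cong-≗; sum-replicate-zero) renaming (sum to ∑)

private
  variable
    v n : ℕ

-- Congruence of integers modulo `v`, and residues.

-- A record rather than an abbreviation, so that unification recovers `a` and `b`, which an unfolded
-- difference does not determine.
record Congruent (v : ℕ) (a b : ℤ) : Set where
  constructor congruent
  field difference : + v ℤDiv.∣ a ℤ.- b

congruent-sym : ∀ {a b} → Congruent v a b → Congruent v b a
congruent-sym {v} {a} {b} (congruent p) = congruent (subst (+ v ℤDiv.∣_) (lemma a b) (ℤDiv.∣m⇒∣-m p))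
  where
  lemma : ∀ a b → ℤ.- (a ℤ.- b) ≡ b ℤ.- a
  lemma = ℤSolver.solve-∀

congruent-trans : ∀ {a b c} → Congruent v a b → Congruent v b c → Congruent v a c
congruent-trans {v} {a} {b} {c} (congruent p) (congruent q) =
  congruent (subst (+ v ℤDiv.∣_) (lemma a b c) (ℤDiv.∣m∣n⇒∣m+n p q))
  where
  lemma : ∀ a b c → (a ℤ.- b) ℤ.+ (b ℤ.- c) ≡ a ℤ.- c
  lemma = ℤSolver.solve-∀

congruent-+ : ∀ {a b c d} → Congruent v a b → Congruent v c d → Congruent v (a ℤ.+ c) (b ℤ.+ d)
congruent-+ {v} {a} {b} {c} {d} (congruent p) (congruent q) =
  congruent (subst (+ v ℤDiv.∣_) (lemma a b c d) (ℤDiv.∣m∣n⇒∣m+n p q))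
  where
  lemma : ∀ a b c d → (a ℤ.- b) ℤ.+ (c ℤ.- d) ≡ (a ℤ.+ c) ℤ.- (b ℤ.+ d)
  lemma = ℤSolver.solve-∀

congruent-neg : ∀ {a b} → Congruent v a b → Congruent v (ℤ.- a) (ℤ.- b)
congruent-neg {v} {a} {b} (congruent p) = congruent (subst (+ v ℤDiv.∣_) (lemma a b) (ℤDiv.∣m⇒∣-m p))
  where
  lemma : ∀ a b → ℤ.- (a ℤ.- b) ≡ ℤ.- a ℤ.- ℤ.- b
  lemma = ℤSolver.solve-∀

congruent-reflexive : ∀ {a b} → a ≡ b → Congruent v a b
congruent-reflexive {v} {a} refl =
  congruent (subst (+ v ℤDiv.∣_) (sym (ℤ.+-inverseʳ a)) (ℤDiv.divides 0ℤ refl))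

congruent⇒∣ : ∀ {a b} → Congruent v a b → v ∣ ∣ a ℤ.- b ∣
congruent⇒∣ (congruent p) = ℤDiv.∣⇒∣ᵤ p

-- Two numbers below `v` differ by less than `v`, and the only multiple of `v` in that range is 0.
toℕ-congruent-injective : (x y : Fin v) → Congruent v (+ toℕ x) (+ toℕ y) → x ≡ y
toℕ-congruent-injective {v} x y p = toℕ-injective (ℤ.+-injective (ℤ.i-j≡0⇒i≡j _ _ (ℤ.∣i∣≡0⇒i≡0 d≡0)))
  where
  instance
    v≢0 = nonZeroIndex x
  d = ∣ + toℕ x ℤ.- + toℕ y ∣
  d<v : d < v
  d<v = ≤-<-trans
    (≤-trans (≤-reflexive (cong ∣_∣ (ℤ.[+m]-[+n]≡m⊖n (toℕ x) (toℕ y)))) (ℤ.∣m⊝n∣≤m⊔n (toℕ x) (toℕ y)))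
    (⊔-lub (toℕ<n x) (toℕ<n y))
  d≡0 : d ≡ 0
  d≡0 = trans (sym (m<n⇒m%n≡m d<v)) (n∣m⇒m%n≡0 d v (congruent⇒∣ p))

-- The remainder `%ℕ` lies in `0, …, v - 1` for negative `z` as well.
residue : ∀ v .{{_ : NonZero v}} → ℤ → Fin v
residue v z = fromℕ< (ℤDivMod.n%ℕd<d z v)

residue-congruent : ∀ v .{{_ : NonZero v}} z → Congruent v z (+ toℕ (residue v z))
residue-congruent v z = congruent (ℤDiv.divides (z ℤDivMod./ℕ v) (begin
  z ℤ.- + toℕ (residue v z)        ≡⟨ cong (λ r → z ℤ.- + r) (toℕ-fromℕ< (ℤDivMod.n%ℕd<d z v)) ⟩
  z ℤ.- r                          ≡⟨ cong (ℤ._- r) (ℤDivMod.a≡a%ℕn+[a/ℕn]*n z v) ⟩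
  (r ℤ.+ q ℤ.* + v) ℤ.- r          ≡⟨ lemma r (q ℤ.* + v) ⟩
  q ℤ.* + v                        ∎))
  where
  open ≡-Reasoning
  r = + (z ℤDivMod.%ℕ v)
  q = z ℤDivMod./ℕ v
  lemma : ∀ a b → (a ℤ.+ b) ℤ.- a ≡ b
  lemma = ℤSolver.solve-∀

mod-congruent : ∀ m v .{{_ : NonZero v}} → Congruent v (+ toℕ (m mod v)) (+ m)
mod-congruent m v = subst (λ x → Congruent v (+ x) (+ m)) toℕ≡
  (congruent-sym (residue-congruent v (+ m)))
  where
  toℕ≡ : toℕ (residue v (+ m)) ≡ toℕ (m mod v)
  toℕ≡ = trans (toℕ-fromℕ< (ℤDivMod.n%ℕd<d (+ m) v)) (sym (toℕ-fromℕ< (m%n<n m v)))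

-- Addition and negation in ℤ_v.

-- The quotient that `⊕` discards. Keeping it replaces a congruence by an equation in ℕ, which can
-- be summed over a subgroup.
carry : Fin v → Fin v → ℕ
carry {v} x y = ((toℕ x + toℕ y) / v) {{nonZeroIndex x}}

toℕ-⊕ : (x y : Fin v) → toℕ x + toℕ y ≡ toℕ (x ⊕ y) + carry x y * v
toℕ-⊕ {v} x y = trans (m≡m%n+[m/n]*n (toℕ x + toℕ y) v {{nonZeroIndex x}})
  (cong (_+ carry x y * v) (sym (toℕ-fromℕ< (m%n<n (toℕ x + toℕ y) v {{nonZeroIndex x}}))))

⊕-congruent : (x y : Fin v) → Congruent v (+ toℕ (x ⊕ y)) (+ toℕ x ℤ.+ + toℕ y)
⊕-congruent {v} x y = mod-congruent (toℕ x + toℕ y) v {{nonZeroIndex x}}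

∸-congruent : ∀ {m} → m ≤ v → Congruent v (+ (v ∸ m)) (ℤ.- + m)
∸-congruent {v} {m} m≤v = congruent (ℤDiv.divides (+ 1) (begin
  + (v ∸ m) ℤ.- ℤ.- + m   ≡⟨ cong (ℤ._+_ (+ (v ∸ m))) (ℤ.neg-involutive (+ m)) ⟩
  + (v ∸ m + m)           ≡⟨ cong +_ (m∸n+n≡m m≤v) ⟩
  + v                     ≡⟨ ℤ.*-identityˡ (+ v) ⟨
  + 1 ℤ.* + v             ∎))
  where open ≡-Reasoning

⊖-congruent : (x : Fin v) → Congruent v (+ toℕ (⊖ x)) (ℤ.- + toℕ x)
⊖-congruent {v} x = congruent-trans
  (mod-congruent (v ∸ toℕ x) v {{nonZeroIndex x}}) (∸-congruent (<⇒≤ (toℕ<n x)))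

⊕-⊖-cancelʳ : (y x : Fin v) → (y ⊕ x) ⊕ (⊖ x) ≡ y
⊕-⊖-cancelʳ y x = toℕ-congruent-injective _ _
  (congruent-trans (⊕-congruent (y ⊕ x) (⊖ x))
  (congruent-trans
    (congruent-+ (⊕-congruent y x) (⊖-congruent x))
    (congruent-reflexive (lemma (+ toℕ y) (+ toℕ x)))))
  where
  lemma : ∀ a b → (a ℤ.+ b) ℤ.+ ℤ.- b ≡ a
  lemma = ℤSolver.solve-∀

⊖-⊕-cancelʳ : (y x : Fin v) → (y ⊕ (⊖ x)) ⊕ x ≡ y
⊖-⊕-cancelʳ y x = toℕ-congruent-injective _ _
  (congruent-trans (⊕-congruent (y ⊕ (⊖ x)) x)
  (congruent-trans
    (congruent-+
      (congruent-trans (⊕-congruent y (⊖ x)) (congruent-+ (congruent-reflexive {a = + toℕ y} refl) (⊖-congruent x)))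
      (congruent-reflexive {a = + toℕ x} refl))
    (congruent-reflexive (lemma (+ toℕ y) (+ toℕ x)))))
  where
  lemma : ∀ a b → (a ℤ.+ ℤ.- b) ℤ.+ b ≡ a
  lemma = ℤSolver.solve-∀

-- Lagrange's theorem for subgroups of ℤ_v.

∑-*ʳ : ∀ {n} (f : Fin n → ℕ) c → ∑ (λ i → f i * c) ≡ ∑ f * c
∑-*ʳ {zero}  f c = refl
∑-*ʳ {suc n} f c = trans (cong (_+_ (f zero * c)) (∑-*ʳ (f ∘ suc) c)) (sym (*-distribʳ-+ c (f zero) _))

indicator : Bool → ℕ
indicator b = if b then 1 else 0

∑-indicator : ∀ {n} (J : Subset n) → ∑ (indicator ∘ lookup J) ≡ Subset.∣ J ∣
∑-indicator []          = refl
∑-indicator (true  ∷ J) = cong suc (∑-indicator J)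
∑-indicator (false ∷ J) = ∑-indicator J

-- Translation by x permutes J, so it preserves the sum of the elements of J;
-- on the other hand it adds |J| x to that sum, up to a multiple of v.
subgroup-order-annihilates : (J : Subset v) → IsSubgroup J → ∀ x → x Subset.∈ J →
  v ∣ Subset.∣ J ∣ * toℕ x
subgroup-order-annihilates {v} J isSubgroup x x∈J = divides (∑ c) (+-cancelˡ-≡ (∑ f) _ _ total)
  where
  open IsSubgroup isSubgroup
  open ≡-Reasoning
  ι = indicator ∘ lookup J
  f = λ y → ι y * toℕ y
  c = λ y → ι y * carry y x
  translation : Permutation v v
  translation = permutation (_⊕ x) (_⊕ (⊖ x)) (λ y → ⊖-⊕-cancelʳ y x) (λ y → ⊕-⊖-cancelʳ y x)
  ι-translate : ∀ y → ι (y ⊕ x) ≡ ι y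
  ι-translate y with lookup J y in p | lookup J (y ⊕ x) in q
  ... | true  | true  = refl
  ... | false | false = refl
  ... | true  | false = contradiction
    (trans (sym q) ([]=⇒lookup (closed-⊕ y x (lookup⇒[]= y J p) x∈J))) λ ()
  -- Adding `⊖ x`, which is in `J`, to `y ⊕ x` leads back to `y`, so `y` would lie in `J` too.
  ... | false | true  = contradiction
    (trans (sym p) ([]=⇒lookup (subst (Subset._∈ J) (⊕-⊖-cancelʳ y x)
      (closed-⊕ _ _ (lookup⇒[]= (y ⊕ x) J q) (closed-⊖ x x∈J))))) λ ()
  step : ∀ y → f y + ι y * toℕ x ≡ f (y ⊕ x) + c y * v
  step y = begin
    ι y * toℕ y + ι y * toℕ x              ≡⟨ *-distribˡ-+ (ι y) (toℕ y) (toℕ x) ⟨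
    ι y * (toℕ y + toℕ x)                  ≡⟨ cong (ι y *_) (toℕ-⊕ y x) ⟩
    ι y * (toℕ (y ⊕ x) + carry y x * v)      ≡⟨ *-distribˡ-+ (ι y) _ _ ⟩
    ι y * toℕ (y ⊕ x) + ι y * (carry y x * v)
      ≡⟨ cong₂ _+_ (cong (_* toℕ (y ⊕ x)) (sym (ι-translate y))) (sym (*-assoc (ι y) _ v)) ⟩
    f (y ⊕ x) + c y * v                    ∎
  total : ∑ f + Subset.∣ J ∣ * toℕ x ≡ ∑ f + ∑ c * v
  total = begin
    ∑ f + Subset.∣ J ∣ * toℕ x               ≡⟨ cong (λ t → ∑ f + t * toℕ x) (∑-indicator J) ⟨
    ∑ f + ∑ ι * toℕ x                        ≡⟨ cong (_+_ (∑ f)) (∑-*ʳ ι (toℕ x)) ⟨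
    ∑ f + ∑ (λ y → ι y * toℕ x)              ≡⟨ ∑-distrib-+ f _ ⟨
    ∑ (λ y → f y + ι y * toℕ x)              ≡⟨ sum-cong-≗ step ⟩
    ∑ (λ y → f (y ⊕ x) + c y * v)            ≡⟨ ∑-distrib-+ (λ y → f (y ⊕ x)) _ ⟩
    ∑ (λ y → f (y ⊕ x)) + ∑ (λ y → c y * v)  ≡⟨ cong₂ _+_ (sum-permute f translation) (sym (∑-*ʳ c v)) ⟨
    ∑ f + ∑ c * v                            ∎

-- The subgroup of multiples of `d`.

∑< : ℕ → (ℕ → ℕ) → ℕ
∑< m g = ∑ {m} (g ∘ toℕ)

∑<-+ : ∀ a b g → ∑< (a + b) g ≡ ∑< a g + ∑< b (λ i → g (a + i))
∑<-+ zero    b g = refl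
∑<-+ (suc a) b g = trans (cong (_+_ (g 0)) (∑<-+ a b (g ∘ suc))) (sym (+-assoc (g 0) _ _))

∑<-periodic : ∀ q d g → (∀ i → g (d + i) ≡ g i) → ∑< (q * d) g ≡ q * ∑< d g
∑<-periodic zero    d g period = refl
∑<-periodic (suc q) d g period = trans (∑<-+ d (q * d) g) (cong (_+_ (∑< d g))
  (trans (sum-cong-≗ {q * d} (period ∘ toℕ)) (∑<-periodic q d g period)))

-- When `v = q * d` with `d` nonzero, this is the subgroup of order `q`.
multiples : ℕ → ∀ v → Subset v
multiples d v = tabulate (λ i → does (d ∣? toℕ i))

∈-multiples⁺ : ∀ {d} {x : Fin v} → d ∣ toℕ x → x Subset.∈ multiples d v
∈-multiples⁺ {d = d} {x} d∣x = lookup⇒[]= x _ (trans (lookup∘tabulate _ x) (dec-true (d ∣? toℕ x) d∣x))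

∈-multiples⁻ : ∀ {d} {x : Fin v} → x Subset.∈ multiples d v → d ∣ toℕ x
∈-multiples⁻ {d = d} {x} x∈ with d ∣? toℕ x
... | yes d∣x = d∣x
... | no  d∤x = contradiction
  (trans (sym (dec-false (d ∣? toℕ x) d∤x)) (trans (sym (lookup∘tabulate _ x)) ([]=⇒lookup x∈))) λ ()

-- Divisibility by `d` is periodic with period `d`, and 0 is the only multiple of `d` among
-- `0, …, d - 1`. Hence each of the `q` blocks of length `d` contributes 1.
∣multiples∣ : ∀ q d .{{_ : NonZero d}} → Subset.∣ multiples d (q * d) ∣ ≡ q
∣multiples∣ q d@(suc d-1) = begin
  Subset.∣ multiples d (q * d) ∣           ≡⟨ ∑-indicator (multiples d (q * d)) ⟨
  ∑ (indicator ∘ lookup (multiples d (q * d)))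
    ≡⟨ sum-cong-≗ {q * d} (λ i → cong indicator (lookup∘tabulate _ i)) ⟩
  ∑< (q * d) g                             ≡⟨ ∑<-periodic q d g period ⟩
  q * suc (∑< d-1 (g ∘ suc))
    ≡⟨ cong (λ s → q * suc s) (trans (sum-cong-≗ {d-1} rest) (sum-replicate-zero d-1)) ⟩
  q * 1                                    ≡⟨ *-identityʳ q ⟩
  q                                        ∎
  where
  open ≡-Reasoning
  g : ℕ → ℕ
  g i = indicator (does (d ∣? i))
  period : ∀ i → g (d + i) ≡ g i
  period i with d ∣? i
  ... | yes d∣i = cong indicator (trans (dec-true (d ∣? (d + i)) (∣m∣n⇒∣m+n ∣-refl d∣i)) (sym (dec-true (d ∣? i) d∣i)))
  ... | no  d∤i = cong indicator (trans
    (dec-false (d ∣? (d + i)) (λ d∣d+i → d∤i (∣m+n∣m⇒∣n d∣d+i ∣-refl))) (sym (dec-false (d ∣? i) d∤i)))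
  rest : ∀ (i : Fin d-1) → g (suc (toℕ i)) ≡ 0
  rest i = cong indicator (dec-false (d ∣? suc (toℕ i)) (>⇒∤ (s≤s (toℕ<n i))))

∣v∸m⇒∣m : ∀ {d m} → d ∣ v → m ≤ v → d ∣ v ∸ m → d ∣ m
∣v∸m⇒∣m {d = d} d∣v m≤v d∣v∸m = ∣m+n∣m⇒∣n (subst (d ∣_) (sym (m∸n+n≡m m≤v)) d∣v) d∣v∸m

multiples-isSubgroup : ∀ {d} → d ∣ v → IsSubgroup (multiples d v)
multiples-isSubgroup {v} {d} d∣v = record
  { contains-0 = λ x x≡0 → ∈-multiples⁺ (subst (d ∣_) (sym x≡0) (d ∣0))
  ; closed-⊕   = λ x y x∈ y∈ → reduce x (∣m∣n⇒∣m+n (∈-multiples⁻ x∈) (∈-multiples⁻ y∈))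
  ; closed-⊖   = λ x x∈ → reduce x (∣m+n∣m⇒∣n
      (subst (d ∣_) (sym (m+[n∸m]≡n (<⇒≤ (toℕ<n x)))) d∣v) (∈-multiples⁻ x∈))
  }
  where
  reduce : ∀ (x : Fin v) {m} → d ∣ m → (m mod v) {{nonZeroIndex x}} Subset.∈ multiples d v
  reduce x {m} d∣m = ∈-multiples⁺ (subst (d ∣_) (sym (toℕ-fromℕ< _)) (%-presˡ-∣ {{nonZeroIndex x}} d∣m d∣v))

-- Reduction of integer arrays to Heffter arrays.

modulus≡* : ∀ n k → modulus k n k ≡ k * (2 * n + 1)
modulus≡* = lemma
  where
  lemma : ∀ n k → 2 * n * k + k ≡ k * (2 * n + 1)
  lemma = solve-∀

2n+1≢0 : ∀ n → NonZero (2 * n + 1)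
2n+1≢0 n = >-nonZero (m≤n+m 1 (2 * n))

entries-map : {X Y : Set} (f : X → Y) (line : Vector (Maybe X) n) →
  entries (Maybe.map f ∘ line) ≡ map f (entries line)
entries-map f line =
  trans (cong catMaybes (sym (map-tabulate line (Maybe.map f)))) (sym (map-catMaybes f (toList line)))

length-entries-pointwise : {X Y : Set} {R : X → Y → Set} (f : Vector (Maybe X) n) (g : Vector (Maybe Y) n) →
  (∀ i → Pointwise R (f i) (g i)) → length (entries f) ≡ length (entries g)
length-entries-pointwise {zero}  f g r = refl
length-entries-pointwise {suc n} f g r with f zero | g zero | r zero
... | just _  | just _  | just _  = cong suc (length-entries-pointwise (f ∘ suc) (g ∘ suc) (r ∘ suc))
... | nothing | nothing | nothing = length-entries-pointwise (f ∘ suc) (g ∘ suc) (r ∘ suc)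

-- An integer H_k(n;k) without its residues and without J, both of which are
-- determined: J consists of the multiples of 2n+1.
record IsIntegerArray (n k : ℕ) (C : PFArray n n ℤ) : Set where
  field
    filled  : EveryLine (λ zs → length zs ≡ k) C
    sums    : EveryLine SumsToZero C
    bounded : ∀ z → z AppearsIn C → 1 ≤ ∣ z ∣ × ∣ z ∣ ≤ modulus k n k / 2
    covers  : ∀ r → r ≤ modulus k n k / 2 → ¬ (2 * n + 1 ∣ r) → supp C r

-- Each integer is congruent to its residue, so the total of the residues is congruent to the
-- integer sum, which is 0.
residues-sum : ∀ .{{_ : NonZero v}} zs → SumsToZero zs → SumsToZeroMod v (map (residue v) zs)
residues-sum {v} zs zs≡0 = subst (v ∣_) abs≡
  (congruent⇒∣ (congruent-trans (congruent-sym (sum-congruent zs)) (congruent-reflexive zs≡0)))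
  where
  total : List ℤ → ℕ
  total zs = sum (map toℕ (map (residue v) zs))
  sum-congruent : ∀ zs → Congruent v (foldr ℤ._+_ 0ℤ zs) (+ total zs)
  sum-congruent []       = congruent-reflexive refl
  sum-congruent (z ∷ zs) = congruent-+ (residue-congruent v z) (sum-congruent zs)
  abs≡ : ∣ + total zs ℤ.- 0ℤ ∣ ≡ total zs
  abs≡ = cong ∣_∣ (ℤ.+-identityʳ (+ total zs))

residue-unique : .{{_ : NonZero v}} (x : Fin v) {z : ℤ} → Congruent v z (+ toℕ x) → residue v z ≡ x
residue-unique {v} x {z} z≈x = toℕ-congruent-injective _ x
  (congruent-trans (congruent-sym (residue-congruent v z)) z≈x)

∣z∣≡m⇒z≡±m : ∀ z {m} → ∣ z ∣ ≡ m → z ≡ + m ⊎ z ≡ ℤ.- + m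
∣z∣≡m⇒z≡±m (+ _)    refl = inj₁ refl
∣z∣≡m⇒z≡±m -[1+ _ ] refl = inj₂ refl

m≤1+m/2+m/2 : ∀ m → m ≤ suc (m / 2 + m / 2)
m≤1+m/2+m/2 m = begin
  m                    ≡⟨ m≡m%n+[m/n]*n m 2 ⟩
  m % 2 + m / 2 * 2    ≤⟨ +-mono-≤ (m<1+n⇒m≤n (m%n<n m 2)) (≤-reflexive (lemma (m / 2))) ⟩
  suc (m / 2 + m / 2)  ∎
  where
  open ≤-Reasoning
  lemma : ∀ a → a * 2 ≡ a + a
  lemma = solve-∀

m/2+m/2≤m : ∀ m → m / 2 + m / 2 ≤ m
m/2+m/2≤m m = subst (_≤ m) (lemma (m / 2)) (m/n*n≤m m 2)
  where
  lemma : ∀ a → a * 2 ≡ a + a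
  lemma = solve-∀

-- One of `toℕ x` and `v ∸ toℕ x` is at most `v / 2`, and neither is a multiple of `d` because `d`
-- divides `v`. So one of them is the absolute value of an entry of `C`, and the residue of that
-- entry is `x` or `⊖ x` according to its sign.
appears-up-to-sign : .{{_ : NonZero v}} (C : PFArray n n ℤ) {d : ℕ} → d ∣ v →
  (∀ r → r ≤ v / 2 → ¬ (d ∣ r) → supp C r) →
  (x : Fin v) → ¬ (d ∣ toℕ x) →
  (x AppearsIn (λ i j → Maybe.map (residue v) (C i j))) ⊎
  ((⊖ x) AppearsIn (λ i j → Maybe.map (residue v) (C i j)))
appears-up-to-sign {v} {n} C {d} d∣v covers x d∤x with toℕ x ≤? v / 2
... | yes x≤v/2 = appear (covers (toℕ x) x≤v/2 d∤x)
  where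
  appear : supp C (toℕ x) → _
  appear (z , (i , j , Cij≡z) , ∣z∣≡x) with ∣z∣≡m⇒z≡±m z ∣z∣≡x
  ... | inj₁ refl = inj₁ (i , j , trans (cong (Maybe.map (residue v)) Cij≡z)
    (cong just (residue-unique x (congruent-reflexive refl))))
  ... | inj₂ refl = inj₂ (i , j , trans (cong (Maybe.map (residue v)) Cij≡z)
    (cong just (residue-unique (⊖ x) (congruent-sym (⊖-congruent x)))))
... | no  x≰v/2 = appear (covers (v ∸ toℕ x) v∸x≤v/2 (d∤x ∘ ∣v∸m⇒∣m d∣v (<⇒≤ (toℕ<n x))))
  where
  v∸x≤v/2 : v ∸ toℕ x ≤ v / 2
  -- For odd `v` two halves fall short of `v` by 1; the strict inequality `v / 2 < toℕ x` makes up
  -- for it.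
  v∸x≤v/2 = m≤n+o⇒m∸n≤o v (toℕ x) (≤-trans (m≤1+m/2+m/2 v) (+-monoˡ-≤ (v / 2) (≰⇒> x≰v/2)))
  v∸x≈-x : Congruent v (+ (v ∸ toℕ x)) (ℤ.- + toℕ x)
  v∸x≈-x = ∸-congruent (<⇒≤ (toℕ<n x))
  appear : supp C (v ∸ toℕ x) → _
  appear (z , (i , j , Cij≡z) , ∣z∣≡v-x) with ∣z∣≡m⇒z≡±m z ∣z∣≡v-x
  ... | inj₁ refl = inj₂ (i , j , trans (cong (Maybe.map (residue v)) Cij≡z)
    (cong just (residue-unique (⊖ x) (congruent-trans v∸x≈-x (congruent-sym (⊖-congruent x))))))
  ... | inj₂ refl = inj₁ (i , j , trans (cong (Maybe.map (residue v)) Cij≡z)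
    (cong just (residue-unique x (congruent-trans (congruent-neg v∸x≈-x) (congruent-reflexive (ℤ.neg-involutive (+ toℕ x)))))))

integerArray⇒heffter : ∀ {n k} (C : PFArray n n ℤ) → 0 < n → 0 < k → IsIntegerArray n k C →
  ∃[ A ] IsIntegerHeffter k n k A
integerArray⇒heffter {n} {k} C 0<n 0<k isArray = A , record
  { isHeffter = record
    { n-positive = 0<n
    ; k-positive = 0<k
    ; t-positive = 0<k
    ; t-divides  = n∣m*n (2 * n)
    ; J          = multiples d V
    ; J-subgroup = multiples-isSubgroup d∣V
    ; J-order    = subst (λ v → Subset.∣ multiples d v ∣ ≡ k) (sym (modulus≡* n k)) (∣multiples∣ k d {{2n+1≢0 n}})
    ; filled     = (λ i → filled-line (C i) (proj₁ filled i))
                 , (λ j → filled-line (transpose C j) (proj₂ filled j))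
    ; covers     = λ x x∉J → appears-up-to-sign C d∣V covers x (x∉J ∘ ∈-multiples⁺)
    ; sums       = (λ i → sum-line (C i) (proj₁ sums i))
                 , (λ j → sum-line (transpose C j) (proj₂ sums j))
    }
  ; asIntegers   = C
  ; represents   = represents
  ; integer-sums = sums
  }
  where
  open IsIntegerArray isArray
  V = modulus k n k
  d = 2 * n + 1
  instance
    V≢0 : NonZero V
    V≢0 = >-nonZero (≤-trans 0<k (m≤n+m k (2 * n * k)))
  d∣V : d ∣ V
  d∣V = subst (d ∣_) (sym (modulus≡* n k)) (n∣m*n k)
  A : PFArray n n (Fin V)
  A i j = Maybe.map (residue V) (C i j)
  filled-line : ∀ line → length (entries line) ≡ k → length (entries (Maybe.map (residue V) ∘ line)) ≡ k
  filled-line line p = trans (cong length (entries-map (residue V) line)) (trans (length-map (residue V) (entries line)) p)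
  sum-line : ∀ line → SumsToZero (entries line) → SumsToZeroMod V (entries (Maybe.map (residue V) ∘ line))
  sum-line line p = subst (SumsToZeroMod V) (sym (entries-map (residue V) line)) (residues-sum (entries line) p)
  represents : ∀ i j → Pointwise Represents (A i j) (C i j)
  represents i j with C i j in Cij≡
  ... | nothing = nothing
  ... | just z  = just (congruent⇒∣ (residue-congruent V z) , bounded z (i , j , Cij≡))

-- From Heffter arrays back to integer arrays.

-- If `z` differs from `r`, their distance is at least `v`, yet it is at most `∣ z ∣ + r`. As both
-- summands are bounded by `v / 2`, both must equal it. This case does occur: for even positive `v`,
-- the integers `v/2` and `-v/2` are congruent.
abs-residue-unique : ∀ z {r} → Congruent v z (+ r) → ∣ z ∣ ≤ v / 2 → r ≤ v / 2 → ∣ z ∣ ≡ r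
abs-residue-unique {v} z {r} z≈r ∣z∣≤ r≤ with ∣ z ℤ.- + r ∣ in d≡
... | zero  = cong ∣_∣ (ℤ.i-j≡0⇒i≡j z (+ r) (ℤ.∣i∣≡0⇒i≡0 d≡))
... | suc _ = trans (≤-antisym ∣z∣≤ half≤∣z∣) (≤-antisym half≤r r≤)
  where
  2half≤∣z∣+r : v / 2 + v / 2 ≤ ∣ z ∣ + r
  2half≤∣z∣+r = ≤-trans (m/2+m/2≤m v)
    (≤-trans (∣⇒≤ {{subst NonZero (sym d≡) _}} (congruent⇒∣ z≈r)) (ℤ.∣i-j∣≤∣i∣+∣j∣ z (+ r)))
  half≤∣z∣ : v / 2 ≤ ∣ z ∣
  half≤∣z∣ = +-cancelʳ-≤ (v / 2) _ _ (≤-trans 2half≤∣z∣+r (+-monoʳ-≤ ∣ z ∣ r≤))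
  half≤r : v / 2 ≤ r
  half≤r = +-cancelˡ-≤ (v / 2) _ _ (≤-trans 2half≤∣z∣+r (+-monoˡ-≤ r ∣z∣≤))

-- Line lengths carry over because representatives fill the same cells. The substance is coverage: a
-- non-multiple of `2 * n + 1` avoids `J`, so it or its negative occurs in `A`, and the bound on
-- representatives fixes the absolute value of the corresponding integer.
heffter⇒integerArray : ∀ {n k} {A} (H : IsIntegerHeffter k n k A) →
  IsIntegerArray n k (IsIntegerHeffter.asIntegers H)
heffter⇒integerArray {n} {k} {A} H = record
  { filled  = (λ i → trans (sym (length-entries-pointwise (A i) (C i) (represents i))) (proj₁ filled i))
            , (λ j → trans (sym (length-entries-pointwise (transpose A j) (transpose C j) (λ i → represents i j))) (proj₂ filled j))
  ; sums    = integer-sums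
  ; bounded = bounded
  ; covers  = covers′
  }
  where
  open IsIntegerHeffter H renaming (asIntegers to C)
  open IsHeffter isHeffter
  V = modulus k n k
  0<V : 0 < V
  0<V = ≤-trans k-positive (m≤n+m k (2 * n * k))
  instance
    V≢0 : NonZero V
    V≢0 = >-nonZero 0<V
  bounded : ∀ z → z AppearsIn C → 1 ≤ ∣ z ∣ × ∣ z ∣ ≤ V / 2
  bounded z (i , j , Cij≡z) with A i j | C i j | represents i j
  bounded z (i , j , refl) | just x | just .z | just (_ , bounds) = bounds
  represented : ∀ x → x AppearsIn A → ∃[ z ] z AppearsIn C × Congruent V z (+ toℕ x) × ∣ z ∣ ≤ V / 2
  represented x (i , j , Aij≡x) with A i j | C i j in Cij≡ | represents i j
  represented x (i , j , refl) | just .x | just z | just (z≈x , _ , ∣z∣≤) =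
    z , (i , j , Cij≡) , congruent (ℤDiv.∣ᵤ⇒∣ z≈x) , ∣z∣≤
  covers′ : ∀ r → r ≤ V / 2 → ¬ (2 * n + 1 ∣ r) → supp C r
  covers′ r r≤V/2 d∤r = appear (covers x x∉J)
    where
    r<V : r < V
    r<V = ≤-<-trans r≤V/2 (m/n<m V 2 ≤-refl)
    x : Fin V
    x = fromℕ< r<V
    x≡r : toℕ x ≡ r
    x≡r = toℕ-fromℕ< r<V
    x∉J : x Subset.∉ J
    -- The order `k` of `J` annihilates `x`, so the modulus `k * (2 * n + 1)` divides `k * r`;
    -- cancelling `k` makes `r` a multiple of `2 * n + 1`.
    x∉J x∈J = d∤r (*-cancelˡ-∣ k {{>-nonZero k-positive}}
      (subst₂ _∣_ (modulus≡* n k) (cong₂ _*_ J-order x≡r) (subgroup-order-annihilates J J-subgroup x x∈J)))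
    appear : (x AppearsIn A) ⊎ ((⊖ x) AppearsIn A) → supp C r
    appear (inj₁ x∈A) with represented x x∈A
    ... | z , z∈C , z≈x , ∣z∣≤ =
      z , z∈C , abs-residue-unique z (subst (λ y → Congruent V z (+ y)) x≡r z≈x) ∣z∣≤ r≤V/2
    appear (inj₂ -x∈A) with represented (⊖ x) -x∈A
    -- Here `z` is congruent to `-r`, so uniqueness is applied to `-z`, which has the same absolute
    -- value.
    ... | z , z∈C , z≈-x , ∣z∣≤ = z , z∈C , trans (sym (ℤ.∣-i∣≡∣i∣ z))
      (abs-residue-unique (ℤ.- z) -z≈r (≤-trans (≤-reflexive (ℤ.∣-i∣≡∣i∣ z)) ∣z∣≤) r≤V/2)
      where
      -z≈r : Congruent V (ℤ.- z) (+ r)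
      -z≈r = congruent-trans (congruent-neg (congruent-trans z≈-x (⊖-congruent x)))
        (congruent-reflexive (trans (ℤ.neg-involutive (+ toℕ x)) (cong +_ x≡r)))

-- Entries and sums of overlaid lines.

-- Disjointness ensures that the left-biased `<∣>` discards nothing. The two lines interleave, so
-- the order of concatenation is lost; lengths and sums do not depend on it.
entries-<∣> : {X : Set} (f g : Vector (Maybe X) n) → (∀ i → ¬ (Is-just (f i) × Is-just (g i))) →
  entries (λ i → f i <∣> g i) ↭ entries f ++ entries g
entries-<∣> {zero}  f g disjoint = Perm.refl
entries-<∣> {suc n} f g disjoint with f zero | g zero | disjoint zero | entries-<∣> (f ∘ suc) (g ∘ suc) (disjoint ∘ suc)
... | just _  | just _  | ¬both | rest = contradiction (just tt , just tt) ¬both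
... | just x  | nothing | _     | rest = Perm.prep x rest
... | nothing | just y  | _     | rest = Perm.trans (Perm.prep y rest) (↭-sym (↭-shift y (entries (f ∘ suc)) _))
... | nothing | nothing | _     | rest = rest

entries-all : {X : Set} {P : X → Set} (f : Vector (Maybe X) n) → (∀ i x → f i ≡ just x → P x) → All P (entries f)
entries-all {zero}  f p = []
entries-all {suc n} f p with f zero in f0≡ | entries-all (f ∘ suc) (p ∘ suc)
... | just x  | rest = p zero x f0≡ ∷ rest
... | nothing | rest = rest

sumℤ : List ℤ → ℤ
sumℤ = foldr ℤ._+_ 0ℤ

sumℤ-++ : ∀ xs ys → sumℤ (xs ++ ys) ≡ sumℤ xs ℤ.+ sumℤ ys
sumℤ-++ []       ys = sym (ℤ.+-identityˡ (sumℤ ys))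
sumℤ-++ (x ∷ xs) ys = trans (cong (ℤ._+_ x) (sumℤ-++ xs ys)) (sym (ℤ.+-assoc x _ _))

sumℤ-↭ : ∀ {xs ys} → xs ↭ ys → sumℤ xs ≡ sumℤ ys
sumℤ-↭ p = Permₛ.foldr-commMonoid (setoid ℤ) ℤ.+-0-isCommutativeMonoid (↭⇒↭ₛ p)

-- Shifting entries away from 0.

-- The sign is kept and the absolute value grows by `s`. Zero is moved upwards, so the symmetric
-- behaviour concerns nonzero entries.
shift : ℕ → ℤ → ℤ
shift s (+ m)    = + (m + s)
shift s -[1+ m ] = -[1+ m + s ]

∣shift∣ : ∀ s z → ∣ shift s z ∣ ≡ ∣ z ∣ + s
∣shift∣ s (+ _)    = refl
∣shift∣ s -[1+ _ ] = refl

-- The two sides of `Balanced`, so that a proof of balance is definitionally an equation between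
-- these counts.
positives negatives : List ℤ → ℕ
positives zs = length (filter (0ℤ ℤ.<?_) zs)
negatives zs = length (filter (ℤ._<? 0ℤ) zs)

length-nonzero : ∀ zs → All (_≢ 0ℤ) zs → length zs ≡ positives zs + negatives zs
length-nonzero []                []        = refl
length-nonzero (+ zero   ∷ zs)   (z≢0 ∷ _) = contradiction refl z≢0
length-nonzero (+ suc _  ∷ zs)   (_ ∷ nz)  = cong suc (length-nonzero zs nz)
length-nonzero (-[1+ _ ] ∷ zs)   (_ ∷ nz)  =
  trans (cong suc (length-nonzero zs nz)) (sym (+-suc (positives zs) (negatives zs)))

-- Each positive entry gains `s` and each negative entry loses `s`. The losses stand on the left, so
-- that for a balanced list the same term appears on both sides and cancels.
sumℤ-shift : ∀ s zs → All (_≢ 0ℤ) zs →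
  sumℤ (map (shift s) zs) ℤ.+ + negatives zs ℤ.* + s ≡ sumℤ zs ℤ.+ + positives zs ℤ.* + s
sumℤ-shift s []               []        = refl
sumℤ-shift s (+ zero   ∷ zs)  (z≢0 ∷ _) = contradiction refl z≢0
sumℤ-shift s (+ suc m  ∷ zs)  (_ ∷ nz)  = begin
  (z ℤ.+ + s ℤ.+ S) ℤ.+ N ℤ.* + s     ≡⟨ left z (+ s) S N ⟩
  (z ℤ.+ + s) ℤ.+ (S ℤ.+ N ℤ.* + s)   ≡⟨ cong (ℤ._+_ (z ℤ.+ + s)) (sumℤ-shift s zs nz) ⟩
  (z ℤ.+ + s) ℤ.+ (Z ℤ.+ P ℤ.* + s)   ≡⟨ right z (+ s) Z P ⟩
  (z ℤ.+ Z) ℤ.+ (+ 1 ℤ.+ P) ℤ.* + s   ∎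
  where
  open ≡-Reasoning
  z = + suc m
  S = sumℤ (map (shift s) zs)
  Z = sumℤ zs
  N = + negatives zs
  P = + positives zs
  left : ∀ z s S N → (z ℤ.+ s ℤ.+ S) ℤ.+ N ℤ.* s ≡ (z ℤ.+ s) ℤ.+ (S ℤ.+ N ℤ.* s)
  left = ℤSolver.solve-∀
  right : ∀ z s Z P → (z ℤ.+ s) ℤ.+ (Z ℤ.+ P ℤ.* s) ≡ (z ℤ.+ Z) ℤ.+ (+ 1 ℤ.+ P) ℤ.* s
  right = ℤSolver.solve-∀
sumℤ-shift s (-[1+ m ] ∷ zs)  (_ ∷ nz)  = begin
  (shift s z ℤ.+ S) ℤ.+ (+ 1 ℤ.+ N) ℤ.* + s       ≡⟨ cong (λ w → (w ℤ.+ S) ℤ.+ (+ 1 ℤ.+ N) ℤ.* + s) shift≡ ⟩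
  (z ℤ.- + s ℤ.+ S) ℤ.+ (+ 1 ℤ.+ N) ℤ.* + s       ≡⟨ left z (+ s) S N ⟩
  z ℤ.+ (S ℤ.+ N ℤ.* + s)                         ≡⟨ cong (ℤ._+_ z) (sumℤ-shift s zs nz) ⟩
  z ℤ.+ (Z ℤ.+ P ℤ.* + s)                         ≡⟨ ℤ.+-assoc z Z _ ⟨
  (z ℤ.+ Z) ℤ.+ P ℤ.* + s                         ∎
  where
  open ≡-Reasoning
  z = -[1+ m ]
  S = sumℤ (map (shift s) zs)
  Z = sumℤ zs
  N = + negatives zs
  P = + positives zs
  shift≡ : shift s z ≡ z ℤ.- + s
  shift≡ = ℤ.neg-distrib-+ (+ suc m) (+ s)
  left : ∀ z s S N → (z ℤ.- s ℤ.+ S) ℤ.+ (+ 1 ℤ.+ N) ℤ.* s ≡ z ℤ.+ (S ℤ.+ N ℤ.* s)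
  left = ℤSolver.solve-∀

shift-sumsToZero : ∀ s zs → All (_≢ 0ℤ) zs → Balanced zs → SumsToZero zs → SumsToZero (map (shift s) zs)
shift-sumsToZero s zs nz balanced zs≡0 = trans
  (Group.∙-cancelʳ (AbelianGroup.group ℤ.+-0-abelianGroup) (+ negatives zs ℤ.* + s) _ _
    (trans (sumℤ-shift s zs nz) (cong (λ p → sumℤ zs ℤ.+ + p ℤ.* + s) balanced)))
  zs≡0

-- Half moduli and the gaps `T`.

-- With `h = c * 2` the modulus grows by the even number `c * (2 * n + 1) * 2`, so the floor splits
-- even if the old modulus is odd.
half-modulus-+ : ∀ n k h → 2 ∣ h → modulus (k + h) n (k + h) / 2 ≡ modulus k n k / 2 + h / 2 * (2 * n + 1)
half-modulus-+ n k .(c * 2) (divides-refl c) = begin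
  modulus (k + c * 2) n (k + c * 2) / 2           ≡⟨ cong (_/ 2) (lemma n k c) ⟩
  (modulus k n k + c * (2 * n + 1) * 2) / 2       ≡⟨ +-distrib-/-∣ʳ (modulus k n k) (n∣m*n (c * (2 * n + 1))) ⟩
  modulus k n k / 2 + c * (2 * n + 1) * 2 / 2     ≡⟨ cong (_+_ (modulus k n k / 2)) (m*n/n≡m (c * (2 * n + 1)) 2) ⟩
  modulus k n k / 2 + c * (2 * n + 1)             ≡⟨ cong (λ c′ → modulus k n k / 2 + c′ * (2 * n + 1)) (m*n/n≡m c 2) ⟨
  modulus k n k / 2 + c * 2 / 2 * (2 * n + 1)     ∎
  where
  open ≡-Reasoning
  lemma : ∀ n k c → 2 * n * (k + c * 2) + (k + c * 2) ≡ (2 * n * k + k) + c * (2 * n + 1) * 2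
  lemma = solve-∀

if-true : ∀ {b} {P Q : ℕ → Set} {t} → b ≡ true → (if b then P else Q) t → P t
if-true refl p = p

if-false : ∀ {b} {P Q : ℕ → Set} {t} → b ≡ false → (if b then P else Q) t → Q t
if-false refl q = q

-- The gaps of supp B are exactly those that a shift by ⌊v/2⌋ moves to the
-- multiples of 2n+1.
T-shift : ∀ n k h {t} → T n k h t → 2 * n + 1 ∣ t + modulus k n k / 2
T-shift n k h {t} t∈T with 2 ∣? k
... | yes 2∣k@(divides-refl e) = even (if-true (dec-true (2 ∣? k) 2∣k) t∈T)
  where
  half : modulus k n k / 2 ≡ e * (2 * n + 1)
  half = trans (cong (_/ 2) (lemma n e)) (m*n/n≡m (e * (2 * n + 1)) 2)
    where
    lemma : ∀ n e → 2 * n * (e * 2) + e * 2 ≡ e * (2 * n + 1) * 2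
    lemma = solve-∀
  even : ∃[ j ] 1 ≤ j × j ≤ h / 2 × t ≡ j * (2 * n + 1) → 2 * n + 1 ∣ t + modulus k n k / 2
  even (j , _ , _ , refl) = ∣m∣n⇒∣m+n (n∣m*n j) (divides e half)
... | no 2∤k = odd (if-false (dec-false (2 ∣? k) 2∤k) t∈T)
  where
  e = k / 2
  k≡ : k ≡ 1 + e * 2
  k≡ = trans (m≡m%n+[m/n]*n k 2) (cong (_+ e * 2) (remainder (k % 2) refl (m%n<n k 2)))
    where
    remainder : ∀ r → k % 2 ≡ r → k % 2 < 2 → k % 2 ≡ 1
    remainder 0 p _ = contradiction (m%n≡0⇒n∣m k 2 p) 2∤k
    remainder 1 p _ = p
    remainder (suc (suc r)) p k%2<2 = contradiction (subst (_< 2) p k%2<2) λ { (s≤s (s≤s ())) }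
  -- For odd `k` the modulus `k * (2 * n + 1)` is odd, and halving drops the 1 that is split off
  -- below.
  half : modulus k n k / 2 ≡ n + e * (2 * n + 1)
  half = begin
    modulus k n k / 2                       ≡⟨ cong (λ k → modulus k n k / 2) k≡ ⟩
    modulus (1 + e * 2) n (1 + e * 2) / 2   ≡⟨ cong (_/ 2) (lemma n e) ⟩
    (1 + (n + e * (2 * n + 1)) * 2) / 2     ≡⟨ +-distrib-/-∣ʳ 1 {d = 2} (n∣m*n (n + e * (2 * n + 1))) ⟩
    (n + e * (2 * n + 1)) * 2 / 2           ≡⟨ m*n/n≡m (n + e * (2 * n + 1)) 2 ⟩
    n + e * (2 * n + 1)                     ∎
    where
    open ≡-Reasoning
    lemma : ∀ n e → 2 * n * (1 + e * 2) + (1 + e * 2) ≡ 1 + (n + e * (2 * n + 1)) * 2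
    lemma = solve-∀
  odd : ∃[ j ] j < h / 2 × t ≡ (n + 1) + j * (2 * n + 1) → 2 * n + 1 ∣ t + modulus k n k / 2
  -- The offset `n + 1` in `T` and the offset `n` of the half modulus add up to one more
  -- `2 * n + 1`, which is the 1 in the quotient.
  odd (j , _ , refl) = divides (1 + j + e) (trans (cong (_+_ (n + 1 + j * (2 * n + 1))) half) (lemma n j e))
    where
    lemma : ∀ n j e → (n + 1 + j * (2 * n + 1)) + (n + e * (2 * n + 1)) ≡ (1 + j + e) * (2 * n + 1)
    lemma = solve-∀

-- The overlaid array and the conclusion.

overlay : ℕ → PFArray n n ℤ → PFArray n n ℤ → PFArray n n ℤ
overlay s C B i j = C i j <∣> Maybe.map (shift s) (B i j)

overlay-isIntegerArray : ∀ {n k h} {C B : PFArray n n ℤ} → 2 ∣ h → IsIntegerArray n k C → IsShiftable B →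
  EveryLine (λ zs → length zs ≡ h) B →
  supp B ≐ [ 1 ⋯ (h / 2) * (2 * n + 1) ] ∖ T n k h →
  EveryLine SumsToZero B →
  Empty (skel C ∩ skel B) →
  IsIntegerArray n (k + h) (overlay (modulus k n k / 2) C B)
overlay-isIntegerArray {n} {k} {h} {C} {B} 2∣h isArray shiftable filledB (suppB⊆ , ⊆suppB) sumsB disjoint = record
  { filled  = (λ i → filled-line (C i) (B i) (λ j both → disjoint (i , j) both) (proj₁ filled i) (proj₁ filledB i))
            , (λ j → filled-line (transpose C j) (transpose B j) (λ i both → disjoint (i , j) both) (proj₂ filled j) (proj₂ filledB j))
  ; sums    = (λ i → sum-line (C i) (B i) (λ j both → disjoint (i , j) both)
                (λ j z p → nonzero z (i , j , p)) (proj₁ balanced i) (proj₁ sums i) (proj₁ sumsB i))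
            , (λ j → sum-line (transpose C j) (transpose B j) (λ i both → disjoint (i , j) both)
                (λ i z p → nonzero z (i , j , p)) (proj₂ balanced j) (proj₂ sums j) (proj₂ sumsB j))
  ; bounded = bounded′
  ; covers  = λ r r≤ → covers′ r (≤-trans r≤ (≤-reflexive (half-modulus-+ n k h 2∣h)))
  }
  where
  open IsIntegerArray isArray
  open IsShiftable shiftable
  d = 2 * n + 1
  s = modulus k n k / 2
  is-just-map : ∀ {m : Maybe ℤ} → Is-just (Maybe.map (shift s) m) → Is-just m
  is-just-map {just _} _ = just tt
  line-↭ : ∀ (c b : Vector (Maybe ℤ) n) → (∀ i → ¬ (Is-just (c i) × Is-just (b i))) →
    entries (λ i → c i <∣> Maybe.map (shift s) (b i)) ↭ entries c ++ map (shift s) (entries b)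
  line-↭ c b disj = subst (λ zs → entries (λ i → c i <∣> Maybe.map (shift s) (b i)) ↭ entries c ++ zs) (entries-map (shift s) b)
    (entries-<∣> c (Maybe.map (shift s) ∘ b) (λ i (p , q) → disj i (p , is-just-map q)))
  filled-line : ∀ (c b : Vector (Maybe ℤ) n) → (∀ i → ¬ (Is-just (c i) × Is-just (b i))) →
    length (entries c) ≡ k → length (entries b) ≡ h →
    length (entries (λ i → c i <∣> Maybe.map (shift s) (b i))) ≡ k + h
  filled-line c b disj p q = begin
    length (entries (λ i → c i <∣> Maybe.map (shift s) (b i)))   ≡⟨ ↭-length (line-↭ c b disj) ⟩
    length (entries c ++ map (shift s) (entries b))              ≡⟨ length-++ (entries c) ⟩
    length (entries c) + length (map (shift s) (entries b))
      ≡⟨ cong₂ _+_ p (trans (length-map (shift s) (entries b)) q) ⟩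
    k + h                                                        ∎
    where open ≡-Reasoning
  sum-line : ∀ (c b : Vector (Maybe ℤ) n) → (∀ i → ¬ (Is-just (c i) × Is-just (b i))) →
    (∀ i z → b i ≡ just z → z ≢ 0ℤ) → Balanced (entries b) →
    SumsToZero (entries c) → SumsToZero (entries b) →
    SumsToZero (entries (λ i → c i <∣> Maybe.map (shift s) (b i)))
  sum-line c b disj nz bal p q = begin
    sumℤ (entries (λ i → c i <∣> Maybe.map (shift s) (b i)))   ≡⟨ sumℤ-↭ (line-↭ c b disj) ⟩
    sumℤ (entries c ++ map (shift s) (entries b))              ≡⟨ sumℤ-++ (entries c) _ ⟩
    sumℤ (entries c) ℤ.+ sumℤ (map (shift s) (entries b))
      ≡⟨ cong₂ ℤ._+_ p (shift-sumsToZero s (entries b) (entries-all b nz) bal q) ⟩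
    0ℤ                                                         ∎
    where open ≡-Reasoning
  bounded′ : ∀ z → z AppearsIn overlay s C B → 1 ≤ ∣ z ∣ × ∣ z ∣ ≤ modulus (k + h) n (k + h) / 2
  bounded′ z (i , j , p) rewrite half-modulus-+ n k h 2∣h with C i j in Cij≡ | B i j in Bij≡
  bounded′ z (i , j , refl) | just .z | _ with bounded z (i , j , Cij≡)
  ... | 1≤ , ≤s = 1≤ , ≤-trans ≤s (m≤m+n s _)
  -- The absolute value is `∣ b ∣ + s`, and `∣ b ∣` is at most `h / 2 * d`, exactly the growth of
  -- the half modulus.
  bounded′ .(shift s b) (i , j , refl) | nothing | just b with suppB⊆ (b , (i , j , Bij≡) , refl)
  ... | (1≤ , ≤h) , _ rewrite ∣shift∣ s b =
    ≤-trans 1≤ (m≤m+n ∣ b ∣ s) , ≤-trans (+-monoˡ-≤ s ≤h) (≤-reflexive (+-comm _ s))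
  covers′ : ∀ r → r ≤ s + h / 2 * d → ¬ (d ∣ r) → supp (overlay s C B) r
  covers′ r r≤ d∤r with r ≤? s
  ... | yes r≤s with covers r r≤s d∤r
  ...   | z , (i , j , Cij≡z) , ∣z∣≡r = z , (i , j , cong (_<∣> _) Cij≡z) , ∣z∣≡r
  -- Beyond `s`, the number `r ∸ s` lies in the interval of `supp B`. It is not a gap, since a gap
  -- shifted by `s` would make `r` a multiple of `d`.
  covers′ r r≤ d∤r | no r≰s with ⊆suppB ((m<n⇒0<n∸m (≰⇒> r≰s) , m≤n+o⇒m∸n≤o r s r≤)
    , λ t∈T → d∤r (subst (d ∣_) (m∸n+n≡m (≰⇒≥ r≰s)) (T-shift n k h t∈T)))
  ... | b , (i , j , Bij≡b) , ∣b∣≡ = shift s b , (i , j , at) ,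
    trans (∣shift∣ s b) (trans (cong (_+ s) ∣b∣≡) (m∸n+n≡m (≰⇒≥ r≰s)))
    where
    -- The entry of `B` is visible in the overlay because disjointness forces the cell of `C` to be
    -- empty.
    at : overlay s C B i j ≡ just (shift s b)
    at with C i j in Cij≡
    ... | nothing = cong (Maybe.map (shift s)) Bij≡b
    ... | just _  = contradiction (subst Is-just (sym Cij≡) (just tt) , subst Is-just (sym Bij≡b) (just tt)) (disjoint (i , j))

-- Balance splits the `h` nonzero entries of a row into two equal counts; `0 < n` provides a row to
-- inspect.
shiftable-even : ∀ {h} {B : PFArray n n ℤ} → 0 < n → IsShiftable B → EveryLine (λ zs → length zs ≡ h) B → 2 ∣ h
shiftable-even {suc n} {h} {B} _ shiftable filled = divides (negatives row) (begin
  h                              ≡⟨ proj₁ filled zero ⟨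
  length row                     ≡⟨ length-nonzero row (entries-all (B zero) (λ j z p → nonzero z (zero , j , p))) ⟩
  positives row + negatives row  ≡⟨ cong (_+ negatives row) (proj₁ balanced zero) ⟩
  negatives row + negatives row  ≡⟨ lemma (negatives row) ⟩
  negatives row * 2              ∎)
  where
  open ≡-Reasoning
  open IsShiftable shiftable
  row = entries (B zero)
  lemma : ∀ a → a + a ≡ a * 2
  lemma = solve-∀

theorem4p8 : ∀ (n k h : ℕ)
    (A : PFArray n n (Fin (modulus k n k))) → IsIntegerHeffter k n k A →
    (B : PFArray n n ℤ) → IsShiftable B →
    EveryLine (λ zs → length zs ≡ h) B →
    supp B ≐ [ 1 ⋯ (h / 2) * (2 * n + 1) ] ∖ T n k h →
    EveryLine SumsToZero B →
    Empty (skel A ∩ skel B) →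
    ∃[ A′ ] IsIntegerHeffter (k + h) n (k + h) A′
theorem4p8 n k h A H B shiftable filledB suppB sumsB disjoint =
  integerArray⇒heffter (overlay (modulus k n k / 2) asIntegers B) n-positive (≤-trans k-positive (m≤m+n k h))
    (overlay-isIntegerArray (shiftable-even n-positive shiftable filledB) (heffter⇒integerArray H)
      shiftable filledB suppB sumsB λ (i , j) (c , b) → disjoint (i , j) (is-just (represents i j) c , b))
  where
  open IsIntegerHeffter H
  open IsHeffter isHeffter
  -- `A` and its integer representatives fill the same cells, which transfers disjointness from `A`
  -- to `asIntegers`.
  is-just : ∀ {X Y : Set} {R : X → Y → Set} {x y} → Pointwise R x y → Is-just y → Is-just x
  is-just (just _) _ = just tt
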